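{- Let $M$ be a strongly locally scoped, $\eta$-long term of ground type $o$. Then $$\mathrm{depth}([\![M]\!])\leq\mathrm{depth}(M),\quad\max([\![M]\!])\leq\mathrm{lh}(M),\quad\mathrm{ord}([\![M]\!])\leq\mathrm{ord}(M),\quad\mathcal{N}([\![M]\!])\geq\mathcal{N}(M).$$
   Context: **Terms.** Types are $A,B::=o\mid A\to B$. Terms are those of the simply-typed $\lambda$-calculus à la Church: $M,N::=\lambda x^A.M\mid M\,N\mid x\mid *_A$, with one constant $*_A:A$ for each type $A$. All terms are well-typed, up to $\alpha$-equivalence, and obey Barendregt's convention. $\mathrm{lv}(o)=0$, $\mathrm{lv}(A\to B)=\max(\mathrm{lv}(A)+1,\mathrm{lv}(B))$; the level of a term or variable is that of its type; $\mathrm{ord}(M)$ is the maximal level of a subterm of $M$. **Redexes, lhr.** Prime redexes are pairs $(\lambda x,N)$: $*\,M_1\dots M_n$ and $x\,M_1\dots M_n$ have none; those of $\lambda x.M'$ are those of $M'$; those of $(\lambda x.M')M_1\dots M_n$ ($n\geq1$) are $(\lambda x,M_1)$ plus those of $M'M_2\dots M_n$. Generalized redexes of $M$ are the prime redexes of all subterms of $M$. The head occurrence is the leftmost occurrence of a variable or constant. If it is an occurrence $x_0$ of $x$ and $(\lambda x,N)$ is a prime redex of $M$, then $M\to_{\mathrm{lhr}}M[N/x_0]$ (only $x_0$ is replaced). $\mathcal{N}(M)$ is the length of the lhr sequence of the term $M$. **Conditions.** $\to_\eta$ is the context closure of $M\to_\eta\lambda x^A.M\,x$ ($M:A\to B$,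 $x$ not free in $M$). $M$ is $\eta$-long if whenever $M\to_\eta M'$, $M'$ has more generalized redexes than $M$. $M$ is strongly locally scoped if for every generalized redex $(\lambda x,N)$ in $M$, $N$ is closed. **Measures on terms.** $\mathrm{depth}(*M_1\dots M_n)=1$; $\mathrm{depth}(x\,M_1\dots M_n)=\max_i\mathrm{depth}(M_i)$ (equal to $1$ if $n=0$); $\mathrm{depth}(\lambda x.M)=\mathrm{depth}(M)$; $\mathrm{depth}((\lambda x.M)M_1\dots M_n)=\max(\mathrm{depth}(M\,M_2\dots M_n),\mathrm{depth}(M_1)+1)$. $\mathrm{lh}(*M_1\dots M_n)=0$; $\mathrm{lh}(x\,M_1\dots M_n)=1+\max_i\mathrm{lh}(M_i)$ (equal to $1$ if $n=0$); $\mathrm{lh}(\lambda x.M)=\mathrm{lh}(M)$; $\mathrm{lh}((\lambda x.M)M_1\dots M_n)=\max(\mathrm{lh}(M\,M_2\dots M_n),\mathrm{lh}(M_1))$. **Skeletons.** A skeleton is a finite tree with nodes and edges labeled by natural numbers; $n[\{d_1\}a_1,\dots,\{d_p\}a_p]$ has root label $n$ and subtrees $a_k$ along edges labeled $d_k$; $n$ denotes $n[\,]$. $a\cdot_db$ is $a$ with an extra child $b$ attached to its root by an edge labeled $d$. $\mathrm{ord}(a)$ is the maximal edge label ($0$ if no edge), $\max(a)$ the maximal node label, $\mathrm{depth}(a)$ the maximal depth of a node (root at depth $1$). Reduction (only at the root): $n[\{d_1\}a_1,\dots,\{d_p\}a_p]\leadsto a_i\cdot_{d_i-1}(n-1)[\{d_1\}a_1,\dots,\{d_p\}a_p]$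 when $n,d_i\geq1$; $\mathcal{N}(a)$ is the length of the longest reduction sequence from the skeleton $a$. $\bigsqcup_{i=1}^na_i$ has as root label the maximum of the root labels of the $a_i$, and as children all children of all the $a_i$ (with their edge labels); the empty $\bigsqcup$ is $0$. $1+a$ is $a$ with its root label increased by $1$. **Interpretation.** For a partial function $\rho$ from variables to skeletons, by induction on length: $[\![*M_1\dots M_n]\!]_\rho=0$; $[\![x\,M_1\dots M_n]\!]_\rho=1+\bigsqcup_i[\![M_i]\!]_\rho$ if $\rho(x)$ is undefined; $[\![x\,M_1\dots M_n]\!]_\rho=(1+\bigsqcup_i[\![M_i]\!]_\rho)\cdot_{\mathrm{lv}(x)+1}\rho(x)$ if $\rho(x)$ is defined; $[\![\lambda x.M]\!]_\rho=[\![M]\!]_\rho$; $[\![(\lambda x.M)M_1\dots M_n]\!]_\rho=[\![M\,M_2\dots M_n]\!]_{\rho\cup\{x\mapsto[\![M_1]\!]_\rho\}}$. $[\![M]\!]=[\![M]\!]_\emptyset$. -}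

module Defs where

open import Data.Nat using (ℕ; suc; _+_; _⊔_; _≤_; _<_; _≟_)
open import Data.List using (List; []; _∷_; _++_; map; foldr; concatMap; length; deduplicate)
open import Data.List.Properties using (≡-dec)
open import Data.List.Membership.Propositional using (_∈_)
open import Data.List.Relation.Unary.Any using (here; there)
open import Data.List.Relation.Unary.All using (All)
open import Data.List.Relation.Binary.Subset.Propositional using (_⊆_)
open import Data.List.Relation.Binary.Subset.Propositional.Properties using (∷⁺ʳ; xs⊆x∷xs)
open import Data.Maybe using (Maybe; just; nothing)
import Data.Maybe as Maybe
open import Data.Product using (∃-syntax; _×_; _,_)
open import Relation.Binary.PropositionalEquality using (_≡_; refl)

------------------------------------------------------------------------
-- Types and terms

infixr 6 _⇒_

data Ty : Set where
  o   : Ty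
  _⇒_ : Ty → Ty → Ty

lv : Ty → ℕ
lv o       = 0
lv (A ⇒ B) = suc (lv A) ⊔ lv B

Ctx : Set
Ctx = List Ty

-- Terms up to α-equivalence are represented by intrinsically typed de Bruijn
-- terms; a variable of type A in context Γ is a proof of A ∈ Γ.

infixl 7 _·_
infix  5 ƛ_

data Tm (Γ : Ctx) : Ty → Set where
  var : ∀ {A} → A ∈ Γ → Tm Γ A
  ∗   : ∀ A → Tm Γ A
  ƛ_  : ∀ {A B} → Tm (A ∷ Γ) B → Tm Γ (A ⇒ B)
  _·_ : ∀ {A B} → Tm Γ (A ⇒ B) → Tm Γ A → Tm Γ B

rename : ∀ {Γ Δ A} → Γ ⊆ Δ → Tm Γ A → Tm Δ A
rename r (var x) = var (r x)
rename r (∗ A)   = ∗ A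
rename r (ƛ M)   = ƛ rename (∷⁺ʳ _ r) M
rename r (M · N) = rename r M · rename r N

wk : ∀ {Γ A B} → Tm Γ A → Tm (B ∷ Γ) A
wk = rename (xs⊆x∷xs _ _)

Closed : ∀ {Γ A} → Tm Γ A → Set
Closed {Γ} {A} M = ∃[ M₀ ] M ≡ rename {[]} {Γ} (λ ()) M₀

ord : ∀ {Γ A} → Tm Γ A → ℕ
ord {A = A} (var x) = lv A
ord {A = A} (∗ _)   = lv A
ord {A = A} (ƛ M)   = lv A ⊔ ord M
ord {A = A} (M · N) = lv A ⊔ (ord M ⊔ ord N)

-- Every notion below that is defined by cases on the shape h M₁ … Mₙ, with h a
-- constant, a variable or an abstraction, is computed by structural recursion
-- on the head part of the term, with an extra argument listing what is needed
-- of the pending arguments M₁, …, Mₙ (first argument first).  The shape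
-- (λx.M) M₁ … Mₙ with n ≥ 1 is then an abstraction with a nonempty list; it
-- leads to M M₂ … Mₙ by dropping M₁ from the list.

------------------------------------------------------------------------
-- Redexes

-- A position is a string of child indices, innermost first: the function part
-- of an application and the body of an abstraction are children 0, and the
-- argument of an application is child 1.

Position : Set
Position = List ℕ

-- By Barendregt's convention λx determines one abstraction of the term; here
-- it is given by its position.

record Redex : Set where
  constructor ⟨_,_⟩
  field
    binder       : Position
    {context}    : Ctx
    {type}       : Ty
    argument     : Tm context type

record Argument : Set where
  constructor arg
  field
    {context} : Ctx
    {type}    : Ty
    term      : Tm context type

-- primeRedexes p M as: the prime redexes of M applied to as, M being at
-- position p.

primeRedexes : ∀ {Γ A} → Position → Tm Γ A → List Argument → List Redex
primeRedexes p (var x) as           = []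
primeRedexes p (∗ A)   as           = []
primeRedexes p (ƛ M)   []           = primeRedexes (0 ∷ p) M []
primeRedexes p (ƛ M)   (arg N ∷ as) = ⟨ p , N ⟩ ∷ primeRedexes (0 ∷ p) M as
primeRedexes p (M · N) as           = primeRedexes (0 ∷ p) M (arg N ∷ as)

-- The prime redexes of all subterms.  The same redex may be listed several
-- times, as a prime redex of nested subterms.

redexesAt : ∀ {Γ A} → Position → Tm Γ A → List Redex
redexesAt p M@(var x) = primeRedexes p M []
redexesAt p M@(∗ A)   = primeRedexes p M []
redexesAt p M@(ƛ P)   = primeRedexes p M [] ++ redexesAt (0 ∷ p) P
redexesAt p M@(P · N) = primeRedexes p M [] ++ redexesAt (0 ∷ p) P
                                            ++ redexesAt (1 ∷ p) N

generalizedRedexes : ∀ {Γ A} → Tm Γ A → List Redex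
generalizedRedexes = redexesAt []

-- The number of distinct generalized redexes: each abstraction is paired with
-- at most one argument, so it suffices to count the binders.

#redexes : ∀ {Γ A} → Tm Γ A → ℕ
#redexes M =
  length (deduplicate (≡-dec _≟_) (map Redex.binder (generalizedRedexes M)))

------------------------------------------------------------------------
-- η-long and strongly locally scoped terms

infix 4 _→η_

data _→η_ {Γ : Ctx} : ∀ {A} → Tm Γ A → Tm Γ A → Set where
  η   : ∀ {A B} {M : Tm Γ (A ⇒ B)} → M →η ƛ (wk M · var (here refl))
  ξ   : ∀ {A B} {M M′ : Tm (A ∷ Γ) B} → M →η M′ → ƛ M →η ƛ M′
  ·ˡ  : ∀ {A B} {M M′ : Tm Γ (A ⇒ B)} {N} → M →η M′ → M · N →η M′ · N
  ·ʳ  : ∀ {A B} {M : Tm Γ (A ⇒ B)} {N N′} → N →η N′ → M · N →η M · N′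

EtaLong : ∀ {Γ A} → Tm Γ A → Set
EtaLong M = ∀ {M′} → M →η M′ → #redexes M < #redexes M′

StronglyLocallyScoped : ∀ {Γ A} → Tm Γ A → Set
StronglyLocallyScoped M =
  All (λ r → Closed (Redex.argument r)) (generalizedRedexes M)

------------------------------------------------------------------------
-- Linear head reduction

data Args (Γ : Ctx) : Ty → Set where
  []  : ∀ {A} → Args Γ A
  _∷_ : ∀ {A B} → Tm Γ A → Args Γ B → Args Γ (A ⇒ B)

wkArgs : ∀ {Γ A B} → Args Γ A → Args (B ∷ Γ) A
wkArgs []       = []
wkArgs (N ∷ as) = wk N ∷ wkArgs as

-- For each variable x in scope on the path to the head occurrence, the N such
-- that (λx , N) is a prime redex, if there is one; N is weakened under the
-- abstractions crossed since.

Env : Ctx → Set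
Env Γ = ∀ {A} → A ∈ Γ → Maybe (Tm Γ A)

infixl 5 _▸_

_▸_ : ∀ {Γ A} → Env Γ → Maybe (Tm Γ A) → Env (A ∷ Γ)
(ρ ▸ N) (here refl) = Maybe.map wk N
(ρ ▸ N) (there x)   = Maybe.map wk (ρ x)

-- Replaces the head occurrence by the argument of its prime redex, if any.

headSubst : ∀ {Γ A} → Env Γ → Tm Γ A → Args Γ A → Maybe (Tm Γ A)
headSubst ρ (var x) as       = ρ x
headSubst ρ (∗ A)   as       = nothing
headSubst ρ (ƛ M)   []       = Maybe.map ƛ_ (headSubst (ρ ▸ nothing) M [])
headSubst ρ (ƛ M)   (N ∷ as) = Maybe.map ƛ_ (headSubst (ρ ▸ just N) M (wkArgs as))
headSubst ρ (M · N) as       = Maybe.map (_· N) (headSubst ρ M (N ∷ as))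

infix 4 _→lhr_

_→lhr_ : ∀ {Γ A} → Tm Γ A → Tm Γ A → Set
M →lhr M′ = headSubst (λ _ → nothing) M [] ≡ just M′

------------------------------------------------------------------------
-- Lengths of reduction sequences

data Steps {X : Set} (R : X → X → Set) : ℕ → X → X → Set where
  []  : ∀ {x} → Steps R 0 x x
  _∷_ : ∀ {n x y z} → R x y → Steps R n y z → Steps R (suc n) x z

-- n is the length of the longest R-reduction sequence from x; for
-- deterministic R, of the unique maximal one.

MaxLength : {X : Set} (R : X → X → Set) → X → ℕ → Set
MaxLength R x n = (∃[ y ] Steps R n x y) × (∀ {m y} → Steps R m x y → m ≤ n)

------------------------------------------------------------------------
-- Measures on terms

depthOn : ∀ {Γ A} → Tm Γ A → List ℕ → ℕ
depthOn (var x) ds       = foldr _⊔_ 1 ds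
depthOn (∗ A)   ds       = 1
depthOn (ƛ M)   []       = depthOn M []
depthOn (ƛ M)   (d ∷ ds) = depthOn M ds ⊔ suc d
depthOn (M · N) ds       = depthOn M (depthOn N [] ∷ ds)

depth : ∀ {Γ A} → Tm Γ A → ℕ
depth M = depthOn M []

lhOn : ∀ {Γ A} → Tm Γ A → List ℕ → ℕ
lhOn (var x) hs       = suc (foldr _⊔_ 0 hs)
lhOn (∗ A)   hs       = 0
lhOn (ƛ M)   []       = lhOn M []
lhOn (ƛ M)   (h ∷ hs) = lhOn M hs ⊔ h
lhOn (M · N) hs       = lhOn M (lhOn N [] ∷ hs)

lh : ∀ {Γ A} → Tm Γ A → ℕ
lh M = lhOn M []

------------------------------------------------------------------------
-- Skeletons

-- node n ((d₁ , a₁) ∷ … ∷ (dₚ , aₚ) ∷ []) is n[{d₁}a₁, …, {dₚ}aₚ].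

data Skel : Set where
  node : ℕ → List (ℕ × Skel) → Skel

root : Skel → ℕ
root (node n _) = n

children : Skel → List (ℕ × Skel)
children (node _ cs) = cs

infixl 7 _·⟨_⟩_

_·⟨_⟩_ : Skel → ℕ → Skel → Skel
node n cs ·⟨ d ⟩ b = node n ((d , b) ∷ cs)

mutual
  ordₛ : Skel → ℕ
  ordₛ (node _ cs) = ordsₛ cs

  ordsₛ : List (ℕ × Skel) → ℕ
  ordsₛ []             = 0
  ordsₛ ((d , a) ∷ cs) = (d ⊔ ordₛ a) ⊔ ordsₛ cs

mutual
  maxₛ : Skel → ℕ
  maxₛ (node n cs) = n ⊔ maxsₛ cs

  maxsₛ : List (ℕ × Skel) → ℕ
  maxsₛ []             = 0
  maxsₛ ((_ , a) ∷ cs) = maxₛ a ⊔ maxsₛ cs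

mutual
  depthₛ : Skel → ℕ
  depthₛ (node _ cs) = suc (depthsₛ cs)

  depthsₛ : List (ℕ × Skel) → ℕ
  depthsₛ []             = 0
  depthsₛ ((_ , a) ∷ cs) = depthₛ a ⊔ depthsₛ cs

infix 4 _⇝_

data _⇝_ : Skel → Skel → Set where
  step : ∀ {n d a cs} → (suc d , a) ∈ cs →
         node (suc n) cs ⇝ a ·⟨ d ⟩ node n cs

⨆ : List Skel → Skel
⨆ as = node (foldr _⊔_ 0 (map root as)) (concatMap children as)

1+ : Skel → Skel
1+ (node n cs) = node (suc n) cs

------------------------------------------------------------------------
-- Interpretation of terms as skeletons

SkelEnv : Ctx → Set
SkelEnv Γ = ∀ {A} → A ∈ Γ → Maybe Skel

∅ : ∀ {Γ} → SkelEnv Γ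
∅ _ = nothing

extend : ∀ {Γ A} → SkelEnv Γ → Maybe Skel → SkelEnv (A ∷ Γ)
extend ρ a (here _)  = a
extend ρ a (there x) = ρ x

-- The pending arguments are interpreted in the environment ρ where they occur:
-- the abstractions crossed afterwards bind variables not free in them.

interpOn : ∀ {Γ A} → SkelEnv Γ → Tm Γ A → List Skel → Skel
interpOn {A = A} ρ (var x) as with ρ x
... | nothing = 1+ (⨆ as)
... | just b  = 1+ (⨆ as) ·⟨ lv A + 1 ⟩ b
interpOn ρ (∗ A)   as       = node 0 []
interpOn ρ (ƛ M)   []       = interpOn (extend ρ nothing) M []
interpOn ρ (ƛ M)   (a ∷ as) = interpOn (extend ρ (just a)) M as
interpOn ρ (M · N) as       = interpOn ρ M (interpOn ρ N [] ∷ as)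

⟦_⟧ : ∀ {Γ A} → Tm Γ A → Skel
⟦ M ⟧ = interpOn ∅ M []

-- A linear head step replaces a head variable x by its argument N.  On
-- skeletons this is the reduction choosing the child ⟦ N ⟧ of the root, by
-- which the former root, carrying the interpretation of the arguments of x,
-- becomes a child of ⟦ N ⟧ along the edge lv(x).  That one child is enough:
-- the arguments get bound to variables of N, which do not occur in redex
-- arguments of N by strong local scoping, so that all their occurrences are
-- interpreted at the root.  By η-longness N binds all the arguments of x.
--
-- Reducts need not be strongly locally scoped; the invariant is that the
-- arguments along the path to the head occurrence are, and are η-long.

module Submission where

open import Defs
open import Data.Nat using (ℕ; zero; suc; _+_; _⊔_; pred; _≤_; _<_; z≤n; s≤s; _≟_)
open import Data.Nat.Properties
open import Data.List using (List; []; _∷_; _++_; map; foldr; concatMap; length; deduplicate)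
open import Data.List.Properties using (≡-dec; length-++; ++-identityʳ)
open import Data.List.Membership.Propositional using (_∈_; find; lose)
open import Data.List.Membership.Propositional.Properties
open import Data.List.Membership.Propositional.Properties.WithK using (unique∧set⇒bag)
open import Data.List.Relation.Binary.BagAndSetEquality using (∼bag⇒↭)
open import Data.List.Relation.Binary.Permutation.Propositional.Properties using (↭-length)
open import Data.List.Relation.Binary.Pointwise as Pointwise using (Pointwise; []; _∷_)
open import Data.List.Relation.Binary.Subset.Propositional using (_⊆_)
open import Data.List.Relation.Binary.Subset.Propositional.Properties using (∷⁺ʳ; xs⊆x∷xs)
open import Data.List.Relation.Unary.All as All using (All; []; _∷_)
open import Data.List.Relation.Unary.All.Properties using (++⁻ˡ; ++⁻ʳ; anti-mono)
open import Data.List.Relation.Unary.Any using (here; there)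
open import Data.List.Relation.Unary.Unique.Propositional using (Unique; []; _∷_)
import Data.List.Relation.Unary.Unique.Propositional.Properties as Unique
open import Data.List.Relation.Unary.Unique.DecPropositional.Properties (≡-dec _≟_) using (deduplicate-!)
open import Data.Maybe using (Maybe; just; nothing)
import Data.Maybe as Maybe
open import Data.Empty using (⊥; ⊥-elim)
open import Data.Product using (∃; ∃-syntax; ∃₂; _×_; _,_; proj₁; proj₂)
open import Data.Sum as Sum using (_⊎_; inj₁; inj₂)
open import Data.Unit using (⊤; tt)
open import Function using (_∘_; flip)
open import Function.Bundles using (mk⇔)
open import Induction.WellFounded using (Acc; acc)
open import Relation.Binary.PropositionalEquality

-- Longest reduction sequences

module _ {X : Set} {R : X → X → Set} where

  FinitelyBranching : Set
  FinitelyBranching = ∀ x → ∃[ ys ] (∀ {y} → R x y → y ∈ ys) × All (R x) ys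

  -- By induction on accessibility: a longest nonempty sequence goes through a reduct whose own
  -- longest sequence is maximal among the finitely many reducts.
  maxLength : FinitelyBranching → ∀ {x} → Acc (flip R) x → ∃ (MaxLength R x)
  maxLength fin {x} (acc rs) with fin x
  ... | ys , complete , sound =
    let n , s , bound = longest ys sound in n , s , λ where
      []       → z≤n
      (r ∷ ss) → bound (complete r) ss
    where
    longest : ∀ ys → All (R x) ys →
      ∃[ n ] (∃[ z ] Steps R n x z) × (∀ {m y z} → y ∈ ys → Steps R m y z → suc m ≤ n)
    longest []       []       = 0 , (x , []) , λ ()
    longest (y ∷ ys) (r ∷ sound)
      with maxLength fin (rs r) | longest ys sound
    ... | m , (_ , s) , b | n , s′ , b′ with ≤-total (suc m) n
    ...   | inj₁ m<n = n , s′ , λ where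
      (here refl) ss → ≤-trans (s≤s (b ss)) m<n
      (there p)   ss → b′ p ss
    ...   | inj₂ n≤m = suc m , (_ , r ∷ s) , λ where
      (here refl) ss → s≤s (b ss)
      (there p)   ss → ≤-trans (b′ p ss) n≤m

  -- Turns a bound on lengths into termination; it is applied to linear head reduction, whose bound
  -- comes from skeletons.
  bounded⇒acc : ∀ n {x} → (∀ {m y} → Steps R m x y → m ≤ n) → Acc (flip R) x
  bounded⇒acc zero    b = acc λ r → ⊥-elim (1+n≰n (b (r ∷ [])))
  bounded⇒acc (suc n) b = acc λ r → bounded⇒acc n λ ss → ≤-pred (b (r ∷ ss))

-- Termination of skeleton reduction

infix 4 _↝_ _⊢_◂_ _⊢_◂ₛ_

-- Lowering the root label is allowed as a reduction step, because reduction
-- moves the former root, with its label lowered, below the chosen child.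

data _↝_ : Skel → Skel → Set where
  reduce : ∀ {a b} → a ⇝ b → a ↝ b
  lower  : ∀ {n cs} → node (suc n) cs ↝ node n cs

SN : Skel → Set
SN = Acc (flip _↝_)

-- d , b ⊢ a ◂ a⁺: a⁺ is a with any number of children b attached at any nodes
-- along edges labeled d.

mutual
  data _⊢_◂_ (db : ℕ × Skel) : Skel → Skel → Set where
    node : ∀ {n cs cs⁺} → db ⊢ cs ◂ₛ cs⁺ → db ⊢ node n cs ◂ node n cs⁺

  data _⊢_◂ₛ_ (db : ℕ × Skel) : List (ℕ × Skel) → List (ℕ × Skel) → Set where
    []     : db ⊢ [] ◂ₛ []
    _∷_    : ∀ {e a a⁺ cs cs⁺} → db ⊢ a ◂ a⁺ → db ⊢ cs ◂ₛ cs⁺ → db ⊢ (e , a) ∷ cs ◂ₛ (e , a⁺) ∷ cs⁺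
    attach : ∀ {cs cs⁺} → db ⊢ cs ◂ₛ cs⁺ → db ⊢ cs ◂ₛ db ∷ cs⁺

mutual
  ◂-refl : ∀ {db} a → db ⊢ a ◂ a
  ◂-refl (node n cs) = node (◂ₛ-refl cs)

  ◂ₛ-refl : ∀ {db} cs → db ⊢ cs ◂ₛ cs
  ◂ₛ-refl []             = []
  ◂ₛ-refl ((e , a) ∷ cs) = ◂-refl a ∷ ◂ₛ-refl cs

child-of-◂ₛ : ∀ {db cs cs⁺ e a⁺} → db ⊢ cs ◂ₛ cs⁺ → (e , a⁺) ∈ cs⁺ →
  (∃[ a ] (e , a) ∈ cs × db ⊢ a ◂ a⁺) ⊎ (e , a⁺) ≡ db
child-of-◂ₛ (r ∷ rs)    (here refl) = inj₁ (_ , here refl , r)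
child-of-◂ₛ (r ∷ rs)    (there p) with child-of-◂ₛ rs p
... | inj₁ (a , q , r′) = inj₁ (a , there q , r′)
... | inj₂ eq           = inj₂ eq
child-of-◂ₛ (attach rs) (here eq) = inj₂ eq
child-of-◂ₛ (attach rs) (there p) = child-of-◂ₛ rs p

-- Induction on `d`, then on `SN a`. A reduction into a child of `a` is also possible in `a` itself.
-- A reduction into an attached copy of `b` makes the lowered former root a child of `b` along an
-- edge smaller than `d`, so the claim for that edge applies with `b` as the host.
SN-attach : ∀ d {b} → SN b → ∀ {a} → SN a → ∀ {a⁺} → (d , b) ⊢ a ◂ a⁺ → SN a⁺
SN-attach d {b} snb {node n cs} (acc sna) (node {cs⁺ = cs⁺} rs) = acc reducts
  where
  reducts : ∀ {c} → node n cs⁺ ↝ c → SN c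
  reducts lower = SN-attach d snb (sna lower) (node rs)
  reducts (reduce (step p)) with child-of-◂ₛ rs p
  ... | inj₁ (node k ds , q , node r) =
    SN-attach d snb (sna (reduce (step q))) (node (node rs ∷ r))
  reducts (reduce (step {d = d′} {a = node k ds} p)) | inj₂ refl =
    SN-attach d′ (SN-attach d snb (sna lower) (node rs)) snb (node (attach (◂ₛ-refl ds)))

mutual
  -- The tree is built from a childless root by attaching its subtrees one at a time.
  sn : ∀ a → SN a
  sn (node n cs) = sns n cs

  sns : ∀ n cs → SN (node n cs)
  sns zero    []             = acc λ { (reduce ()) }
  sns (suc n) []             = acc λ { (reduce (step ())) ; lower → sns n [] }
  sns n       ((d , a) ∷ cs) = SN-attach d (sn a) (sns n cs) (node (attach (◂ₛ-refl cs)))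

⇝-acc : ∀ {a} → SN a → Acc (flip _⇝_) a
⇝-acc (acc rs) = acc λ r → ⇝-acc (rs (reduce r))

⇝-finitelyBranching : FinitelyBranching {R = _⇝_}
⇝-finitelyBranching (node zero    cs) = [] , (λ ()) , []
⇝-finitelyBranching (node (suc n) cs) =
  concatMap reducts cs , complete , All.tabulate (sound ∘ find ∘ ∈-concatMap⁻ reducts {xs = cs})
  where
  reducts : ℕ × Skel → List Skel
  reducts (zero  , a) = []
  reducts (suc d , a) = a ·⟨ d ⟩ node n cs ∷ []

  complete : ∀ {b} → node (suc n) cs ⇝ b → b ∈ concatMap reducts cs
  complete (step p) = ∈-concatMap⁺ reducts (lose p (here refl))

  sound : ∀ {b} → ∃[ c ] c ∈ cs × b ∈ reducts c → node (suc n) cs ⇝ b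
  sound ((suc d , a) , p , here refl) = step p

-- Simulation between skeletons

infix 4 _≼_

-- Children are matched without regard to multiplicity: a reduction keeps all children of the former
-- root, so one child can stand for many.
data _≼_ : Skel → Skel → Set where
  node : ∀ {m n cs ds} → m ≤ n →
    (∀ {d a} → (d , a) ∈ cs → ∃₂ λ e b → (e , b) ∈ ds × d ≤ e × a ≼ b) →
    node m cs ≼ node n ds

mutual
  ≼-refl : ∀ a → a ≼ a
  ≼-refl (node n cs) = node ≤-refl λ p → _ , _ , p , ≤-refl , child-≼-refl cs p

  child-≼-refl : ∀ cs {d a} → (d , a) ∈ cs → a ≼ a
  child-≼-refl ((_ , a) ∷ cs) (here refl) = ≼-refl a
  child-≼-refl (c ∷ cs)       (there p)   = child-≼-refl cs p

≼-attach : ∀ {a b d e a′ b′} → a ≼ b → d ≤ e → a′ ≼ b′ → a ·⟨ d ⟩ a′ ≼ b ·⟨ e ⟩ b′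
≼-attach (node le f) d≤e r = node le λ where
  (here refl) → _ , _ , here refl , d≤e , r
  (there p)   → let e , b , q , rest = f p in e , b , there q , rest

≼-simulates : ∀ {a a′ b} → a ≼ b → a ⇝ a′ → ∃[ b′ ] b ⇝ b′ × a′ ≼ b′
≼-simulates (node (s≤s le) f) (step p) with f p
... | suc e , b , q , s≤s d≤e , r = _ , step q , ≼-attach r d≤e (node le f)

≼-simulates-steps : ∀ {n a a′ b} → a ≼ b → Steps _⇝_ n a a′ → ∃[ b′ ] Steps _⇝_ n b b′
≼-simulates-steps le []       = _ , []
≼-simulates-steps le (r ∷ rs) =
  let _ , r′ , le′ = ≼-simulates le r
      _ , rs′      = ≼-simulates-steps le′ rs
  in _ , r′ ∷ rs′

-- Heads with all their arguments

target : ℕ → Ty → Ty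
target zero    A       = A
target (suc k) (A ⇒ B) = target k B
-- Default value: typing excludes more arguments than the type takes.
target (suc k) o       = o

-- Full M k: in M applied to k arguments, and in all its arguments, every
-- occurrence of a variable is the head of an expression of type o, taking into
-- account the arguments it receives through prime redexes.

Full : ∀ {Γ A} → Tm Γ A → ℕ → Set
Full {A = A} (var x) k       = target k A ≡ o
Full         (∗ A)   k       = ⊤
Full         (ƛ M)   zero    = Full M zero
Full         (ƛ M)   (suc k) = Full M k
Full         (M · N) k       = Full M (suc k) × Full N 0

-- Counting generalized redexes

#matched : ∀ {Γ A} → Tm Γ A → ℕ → ℕ
#matched (var x) k       = 0
#matched (∗ A)   k       = 0
#matched (ƛ M)   zero    = #matched M zero
#matched (ƛ M)   (suc k) = suc (#matched M k)
#matched (M · N) k       = #matched M (suc k) + #matched N 0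

-- `#matched` is compositional, unlike the count of deduplicated binders; this list of positions
-- links the two.
matched : ∀ {Γ A} → Position → Tm Γ A → ℕ → List Position
matched p (var x) k       = []
matched p (∗ A)   k       = []
matched p (ƛ M)   zero    = matched (0 ∷ p) M zero
matched p (ƛ M)   (suc k) = p ∷ matched (0 ∷ p) M k
matched p (M · N) k       = matched (0 ∷ p) M (suc k) ++ matched (1 ∷ p) N 0

length-matched : ∀ {Γ A} p (M : Tm Γ A) k → length (matched p M k) ≡ #matched M k
length-matched p (var x) k       = refl
length-matched p (∗ A)   k       = refl
length-matched p (ƛ M)   zero    = length-matched (0 ∷ p) M zero
length-matched p (ƛ M)   (suc k) = cong suc (length-matched (0 ∷ p) M k)
length-matched p (M · N) k       =
  trans (length-++ (matched (0 ∷ p) M (suc k)))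
        (cong₂ _+_ (length-matched (0 ∷ p) M (suc k)) (length-matched (1 ∷ p) N 0))

infix 4 _⊑_

-- Positions are innermost first, so a position below `p` extends `p` at the front of the list.
data _⊑_ (p : Position) : Position → Set where
  refl : p ⊑ p
  step : ∀ {q i} → p ⊑ q → p ⊑ i ∷ q

∷-⊑ : ∀ {i p q} → i ∷ p ⊑ q → p ⊑ q
∷-⊑ refl     = step refl
∷-⊑ (step s) = step (∷-⊑ s)

⊑-length : ∀ {p q} → p ⊑ q → length p ≤ length q
⊑-length refl     = ≤-refl
⊑-length (step s) = m≤n⇒m≤1+n (⊑-length s)

siblings-disjoint : ∀ {p q} → 0 ∷ p ⊑ q → 1 ∷ p ⊑ q → ⊥
siblings-disjoint refl     (step s) = 1+n≰n (⊑-length s)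
siblings-disjoint (step s) refl     = 1+n≰n (⊑-length s)
siblings-disjoint (step s) (step t) = siblings-disjoint s t

matched-⊑ : ∀ {Γ A} p (M : Tm Γ A) k {q} → q ∈ matched p M k → p ⊑ q
matched-⊑ p (ƛ M)   zero    i           = ∷-⊑ (matched-⊑ (0 ∷ p) M zero i)
matched-⊑ p (ƛ M)   (suc k) (here refl) = refl
matched-⊑ p (ƛ M)   (suc k) (there i)   = ∷-⊑ (matched-⊑ (0 ∷ p) M k i)
matched-⊑ p (M · N) k       i with ∈-++⁻ (matched (0 ∷ p) M (suc k)) i
... | inj₁ j = ∷-⊑ (matched-⊑ (0 ∷ p) M (suc k) j)
... | inj₂ j = ∷-⊑ (matched-⊑ (1 ∷ p) N 0 j)

matched-unique : ∀ {Γ A} p (M : Tm Γ A) k → Unique (matched p M k)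
matched-unique p (var x) k       = []
matched-unique p (∗ A)   k       = []
matched-unique p (ƛ M)   zero    = matched-unique (0 ∷ p) M zero
matched-unique p (ƛ M)   (suc k) =
  All.tabulate (λ { i refl → 1+n≰n (⊑-length (matched-⊑ (0 ∷ p) M k i)) })
  ∷ matched-unique (0 ∷ p) M k
matched-unique p (M · N) k       =
  Unique.++⁺ (matched-unique (0 ∷ p) M (suc k)) (matched-unique (1 ∷ p) N 0)
    λ (i , j) → siblings-disjoint (matched-⊑ (0 ∷ p) M (suc k) i) (matched-⊑ (1 ∷ p) N 0 j)

-- A subterm sees only the arguments inside itself, while `k` may also count outer ones, hence the
-- inequality. More arguments only match more abstractions.
primeRedexes⊆matched : ∀ {Γ A} p (M : Tm Γ A) as {k r} → length as ≤ k →
  r ∈ primeRedexes p M as → Redex.binder r ∈ matched p M k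
primeRedexes⊆matched p (ƛ M) []           {zero}  le       i           =
  primeRedexes⊆matched (0 ∷ p) M [] z≤n i
primeRedexes⊆matched p (ƛ M) []           {suc k} le       i           =
  there (primeRedexes⊆matched (0 ∷ p) M [] z≤n i)
primeRedexes⊆matched p (ƛ M) (arg N ∷ as) {suc k} (s≤s le) (here refl) = here refl
primeRedexes⊆matched p (ƛ M) (arg N ∷ as) {suc k} (s≤s le) (there i)   =
  there (primeRedexes⊆matched (0 ∷ p) M as le i)
primeRedexes⊆matched p (M · N) as le i =
  ∈-++⁺ˡ (primeRedexes⊆matched (0 ∷ p) M (arg N ∷ as) (s≤s le) i)

redexesAt⊆matched : ∀ {Γ A} p (M : Tm Γ A) k {r} →
  r ∈ redexesAt p M → Redex.binder r ∈ matched p M k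
redexesAt⊆matched p M@(ƛ P) k i with ∈-++⁻ (primeRedexes p M []) i
redexesAt⊆matched p M@(ƛ P) k       i | inj₁ j = primeRedexes⊆matched p M [] {k} z≤n j
redexesAt⊆matched p M@(ƛ P) zero    i | inj₂ j = redexesAt⊆matched (0 ∷ p) P zero j
redexesAt⊆matched p M@(ƛ P) (suc k) i | inj₂ j = there (redexesAt⊆matched (0 ∷ p) P k j)
redexesAt⊆matched p M@(P · N) k i with ∈-++⁻ (primeRedexes p M []) i
... | inj₁ j = primeRedexes⊆matched p M [] {k} z≤n j
... | inj₂ j with ∈-++⁻ (redexesAt (0 ∷ p) P) j
...   | inj₁ l = ∈-++⁺ˡ (redexesAt⊆matched (0 ∷ p) P (suc k) l)
...   | inj₂ l = ∈-++⁺ʳ (matched (0 ∷ p) P (suc k)) (redexesAt⊆matched (1 ∷ p) N 0 l)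

primeRedexes⊆redexesAt : ∀ {Γ A} p (M : Tm Γ A) → primeRedexes p M [] ⊆ redexesAt p M
primeRedexes⊆redexesAt p (ƛ M)   i = ∈-++⁺ˡ i
primeRedexes⊆redexesAt p (M · N) i = ∈-++⁺ˡ i

-- The first alternative covers abstractions whose argument is pending in `as`: they form no redex
-- within `M` alone.
matched⊆redexes : ∀ {Γ A} p (M : Tm Γ A) as {q} → q ∈ matched p M (length as) →
  ∃[ r ] q ≡ Redex.binder r × (r ∈ primeRedexes p M as ⊎ r ∈ redexesAt p M)
matched⊆redexes p M@(ƛ P) [] i with matched⊆redexes (0 ∷ p) P [] i
... | r , eq , inj₁ j = r , eq , inj₁ j
... | r , eq , inj₂ j = r , eq , inj₂ (∈-++⁺ʳ (primeRedexes p M []) j)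
matched⊆redexes p (ƛ P)   (arg N ∷ as) (here refl) = _ , refl , inj₁ (here refl)
matched⊆redexes p M@(ƛ P) (arg N ∷ as) (there i) with matched⊆redexes (0 ∷ p) P as i
... | r , eq , inj₁ j = r , eq , inj₁ (there j)
... | r , eq , inj₂ j = r , eq , inj₂ (∈-++⁺ʳ (primeRedexes p M []) j)
matched⊆redexes p M@(P · N) as i with ∈-++⁻ (matched (0 ∷ p) P (suc (length as))) i
matched⊆redexes p M@(P · N) as i | inj₁ j with matched⊆redexes (0 ∷ p) P (arg N ∷ as) j
... | r , eq , inj₁ l = r , eq , inj₁ l
... | r , eq , inj₂ l = r , eq , inj₂ (∈-++⁺ʳ (primeRedexes p M []) (∈-++⁺ˡ l))
matched⊆redexes p M@(P · N) as i | inj₂ j with matched⊆redexes (1 ∷ p) N [] j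
... | r , eq , s = r , eq ,
  inj₂ (∈-++⁺ʳ (primeRedexes p M []) (∈-++⁺ʳ (redexesAt (0 ∷ p) P) (inArgument s)))
  where
  inArgument : r ∈ primeRedexes (1 ∷ p) N [] ⊎ r ∈ redexesAt (1 ∷ p) N → r ∈ redexesAt (1 ∷ p) N
  inArgument (inj₁ l) = primeRedexes⊆redexesAt (1 ∷ p) N l
  inArgument (inj₂ l) = l

-- Two lists without repetitions and with the same elements are permutations of each other.
#redexes≡#matched : ∀ {Γ A} (M : Tm Γ A) → #redexes M ≡ #matched M 0
#redexes≡#matched M = trans
  (↭-length (∼bag⇒↭ (unique∧set⇒bag (deduplicate-! binders) (matched-unique [] M 0)
                                      (mk⇔ to from))))
  (length-matched [] M 0)
  where
  binders = map Redex.binder (generalizedRedexes M)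

  to : ∀ {q} → q ∈ deduplicate (≡-dec _≟_) binders → q ∈ matched [] M 0
  to i with ∈-map⁻ Redex.binder (∈-deduplicate⁻ (≡-dec _≟_) binders i)
  ... | r , j , refl = redexesAt⊆matched [] M 0 j

  from : ∀ {q} → q ∈ matched [] M 0 → q ∈ deduplicate (≡-dec _≟_) binders
  from i with matched⊆redexes [] M [] i
  ... | r , refl , inj₁ j =
    ∈-deduplicate⁺ (≡-dec _≟_) (∈-map⁺ Redex.binder (primeRedexes⊆redexesAt [] M j))
  ... | r , refl , inj₂ j = ∈-deduplicate⁺ (≡-dec _≟_) (∈-map⁺ Redex.binder j)

#matched-rename : ∀ {Γ Δ A} (r : Γ ⊆ Δ) (M : Tm Γ A) k → #matched (rename r M) k ≡ #matched M k
#matched-rename r (var x) k       = refl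
#matched-rename r (∗ A)   k       = refl
#matched-rename r (ƛ M)   zero    = #matched-rename (∷⁺ʳ _ r) M zero
#matched-rename r (ƛ M)   (suc k) = cong suc (#matched-rename (∷⁺ʳ _ r) M k)
#matched-rename r (M · N) k       =
  cong₂ _+_ (#matched-rename r M (suc k)) (#matched-rename r N 0)

-- From η-longness to fully applied heads

EtaLongUnder : ∀ {Γ A} → ℕ → Tm Γ A → Set
EtaLongUnder k M = ∀ {M′} → M →η M′ → #matched M k < #matched M′ k

-- With k arguments pending and one more added at the end: either it is not
-- needed by the head, or it creates a redex.

etaLong⇒full : ∀ {Γ A} (M : Tm Γ A) k → EtaLongUnder k M →
  target k A ≡ o ⊎ #matched M k < #matched M (suc k) → Full M k
etaLong⇒full₀ : ∀ {Γ A} (M : Tm Γ A) → EtaLongUnder 0 M → Full M 0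

-- For a variable the second alternative would read `0 < 0`.
etaLong⇒full (var x) k       h (inj₁ eq) = eq
etaLong⇒full (∗ A)   k       h s         = tt
etaLong⇒full (ƛ M)   zero    h s         = etaLong⇒full₀ M λ r → h (ξ r)
etaLong⇒full (ƛ M)   (suc k) h s         =
  etaLong⇒full M k (λ r → ≤-pred (h (ξ r))) (Sum.map₂ ≤-pred s)
etaLong⇒full (M · N) k       h s         =
  etaLong⇒full M (suc k) (λ r → +-cancelʳ-< (#matched N 0) _ _ (h (·ˡ r)))
    (Sum.map₂ (+-cancelʳ-< (#matched N 0) _ _) s) ,
  etaLong⇒full₀ N λ r → +-cancelˡ-< (#matched M (suc k)) _ _ (h (·ʳ r))

etaLong⇒full₀ {A = o}     M h = etaLong⇒full M 0 h (inj₁ refl)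
-- Expanding `M` itself supplies one argument at its end, and by η-longness this creates a redex.
etaLong⇒full₀ {A = A ⇒ B} M h = etaLong⇒full M 0 h
  (inj₂ (subst (#matched M 0 <_) (trans (+-identityʳ _) (#matched-rename _ M 1)) (h η)))

-- Arguments of redexes

interp-rename : ∀ {Γ Δ A} (r : Γ ⊆ Δ) (M : Tm Γ A) {ρ : SkelEnv Γ} {σ : SkelEnv Δ} →
  (∀ {B} (x : B ∈ Γ) → σ (r x) ≡ ρ x) → ∀ as → interpOn σ (rename r M) as ≡ interpOn ρ M as
interp-rename r (var x) {ρ} {σ} h as rewrite h x = refl
interp-rename r (∗ A)   h as       = refl
interp-rename r (ƛ M)   h []       =
  interp-rename (∷⁺ʳ _ r) M (λ { (here refl) → refl ; (there x) → h x }) []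
interp-rename r (ƛ M)   h (a ∷ as) =
  interp-rename (∷⁺ʳ _ r) M (λ { (here refl) → refl ; (there x) → h x }) as
interp-rename r (M · N) {ρ} {σ} h as
  rewrite interp-rename r N {ρ} {σ} h [] = interp-rename r M h _

Constant : ∀ {Γ A} → Tm Γ A → Set
Constant {Γ} M = ∀ (ρ σ : SkelEnv Γ) → interpOn ρ M [] ≡ interpOn σ M []

constant-rename : ∀ {Γ Δ A} (r : Γ ⊆ Δ) (M : Tm Γ A) → Constant M → Constant (rename r M)
constant-rename r M c ρ σ =
  trans (interp-rename r M {λ x → ρ (r x)} {ρ} (λ _ → refl) [])
 (trans (c (λ x → ρ (r x)) (λ x → σ (r x)))
   (sym (interp-rename r M {λ x → σ (r x)} {σ} (λ _ → refl) [])))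

closed⇒constant : ∀ {Γ A} {M : Tm Γ A} → Closed M → Constant M
closed⇒constant (M₀ , eq) = subst Constant (sym eq)
  (λ ρ σ → trans (interp-rename _ M₀ {∅} {ρ} (λ ()) [])
             (sym (interp-rename _ M₀ {∅} {σ} (λ ()) [])))

-- Strong local scoping, with closedness weakened to independence of the
-- environment.

Scoped : ∀ {Γ A} → Tm Γ A → List Argument → Set
Scoped (var x) as           = ⊤
Scoped (∗ A)   as           = ⊤
Scoped (ƛ M)   []           = Scoped M []
Scoped (ƛ M)   (arg N ∷ as) = Constant N × Scoped M as
Scoped (M · N) as           = Scoped M (arg N ∷ as) × Scoped N []

stronglyLocallyScoped⇒scoped : ∀ {Γ A} p (M : Tm Γ A) as →
  All (Closed ∘ Redex.argument) (primeRedexes p M as) →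
  All (Closed ∘ Redex.argument) (redexesAt p M) → Scoped M as
stronglyLocallyScoped⇒scoped p (var x) as hp ha = tt
stronglyLocallyScoped⇒scoped p (∗ A)   as hp ha = tt
stronglyLocallyScoped⇒scoped p M@(ƛ P) [] hp ha =
  stronglyLocallyScoped⇒scoped (0 ∷ p) P [] hp (++⁻ʳ (primeRedexes p M []) ha)
stronglyLocallyScoped⇒scoped p M@(ƛ P) (arg N ∷ as) (c ∷ hp) ha =
  closed⇒constant c ,
  stronglyLocallyScoped⇒scoped (0 ∷ p) P as hp (++⁻ʳ (primeRedexes p M []) ha)
stronglyLocallyScoped⇒scoped p M@(P · N) as hp ha =
  stronglyLocallyScoped⇒scoped (0 ∷ p) P (arg N ∷ as) hp (++⁻ˡ (redexesAt (0 ∷ p) P) hc) ,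
  stronglyLocallyScoped⇒scoped (1 ∷ p) N []
    (anti-mono (primeRedexes⊆redexesAt (1 ∷ p) N) hN) hN
  where
  hc = ++⁻ʳ (primeRedexes p M []) ha
  hN = ++⁻ʳ (redexesAt (0 ∷ p) P) hc

Scoped-rename : ∀ {Γ Δ A} (r : Γ ⊆ Δ) (M : Tm Γ A) {as bs} →
  Pointwise (λ a b → Constant (Argument.term a) → Constant (Argument.term b)) as bs →
  Scoped M as → Scoped (rename r M) bs
Scoped-rename r (var x) hs       s       = tt
Scoped-rename r (∗ A)   hs       s       = tt
Scoped-rename r (ƛ M)   []       s       = Scoped-rename (∷⁺ʳ _ r) M [] s
Scoped-rename r (ƛ M)   (h ∷ hs) (c , s) = h c , Scoped-rename (∷⁺ʳ _ r) M hs s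
Scoped-rename r (M · N) hs       (s , t) =
  Scoped-rename r M (constant-rename r N ∷ hs) s , Scoped-rename r N [] t

Full-rename : ∀ {Γ Δ A} (r : Γ ⊆ Δ) (M : Tm Γ A) k → Full M k → Full (rename r M) k
Full-rename r (var x) k       f       = f
Full-rename r (∗ A)   k       f       = tt
Full-rename r (ƛ M)   zero    f       = Full-rename (∷⁺ʳ _ r) M zero f
Full-rename r (ƛ M)   (suc k) f       = Full-rename (∷⁺ʳ _ r) M k f
Full-rename r (M · N) k       (f , g) = Full-rename r M (suc k) f , Full-rename r N 0 g

-- Substituting arguments in the interpretation

⨆-root : ∀ {a as} → a ∈ as → root a ≤ root (⨆ as)
⨆-root {as = a ∷ as} (here refl) = m≤m⊔n (root a) _
⨆-root {as = a ∷ as} (there i)   = ≤-trans (⨆-root i) (m≤n⊔m (root a) _)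

≼-⨆-attach : ∀ {a as} d x → a ∈ as → a ≼ ⨆ as ·⟨ d ⟩ x
≼-⨆-attach {node n cs} {as} d x i = node (⨆-root i) λ {e} {b} p →
  e , b , there (∈-concatMap⁺ children (lose i p)) , ≤-refl , ≼-refl b

≼-insert : ∀ {a b d c} e x → a ≼ b ·⟨ d ⟩ c → a ·⟨ e ⟩ x ≼ b ·⟨ e ⟩ x ·⟨ d ⟩ c
≼-insert {b = node _ _} e x (node le f) = node le λ where
  (here refl) → e , x , there (here refl) , ≤-refl , ≼-refl x
  (there p)   → let g , b , i , r = f p in g , b , ∷⁺ʳ _ there i , r

-- Matches may be shared, so the new child is sent to `c` even if `c` already matches others.
≼-absorb : ∀ {a b d c e x} → e ≤ d → x ≼ c → a ≼ b ·⟨ d ⟩ c → a ·⟨ e ⟩ x ≼ b ·⟨ d ⟩ c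
≼-absorb {b = node _ _} le r (node le′ f) = node le′ λ where
  (here refl) → _ , _ , here refl , le , r
  (there p)   → f p

module _ (d : ℕ) (c : Skel) where

  -- In Pending ts as′ as, the skeletons as′ and as interpret ts in two
  -- environments related by Extends; in Fits bs A, the further arguments bs are
  -- for a term of type A.

  Extends : ∀ {Γ} → SkelEnv Γ → SkelEnv Γ → Set
  Extends {Γ} ρ′ ρ = ∀ {A} (x : A ∈ Γ) →
    ρ′ x ≡ ρ x ⊎ (ρ x ≡ nothing × ∃[ b ] ρ′ x ≡ just b × suc (lv A) ≤ d × b ≼ c)

  data Pending : List Argument → List Skel → List Skel → Set where
    []  : Pending [] [] []
    _∷_ : ∀ {t ts a′ a as′ as} → a′ ≼ a ·⟨ d ⟩ c × (Constant (Argument.term t) → a′ ≡ a) →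
          Pending ts as′ as → Pending (t ∷ ts) (a′ ∷ as′) (a ∷ as)

  data Fits : List Skel → Ty → Set where
    []  : ∀ {A} → Fits [] A
    _∷_ : ∀ {b bs A B} → suc (lv A) ≤ d × b ≼ c → Fits bs B → Fits (b ∷ bs) (A ⇒ B)

  fits-ground : ∀ {bs A} → Fits bs A → A ≡ o → bs ≡ []
  fits-ground [] eq = refl

  pending-⨆ : ∀ {ts as′ as} → Pending ts as′ as → 1+ (⨆ as′) ≼ 1+ (⨆ as) ·⟨ d ⟩ c
  pending-⨆ h = node (s≤s (roots h)) λ p → child h p
    where
    roots : ∀ {ts as′ as} → Pending ts as′ as → root (⨆ as′) ≤ root (⨆ as)
    roots []                      = z≤n
    roots {as = node _ _ ∷ _} ((node le _ , _) ∷ h) = ⊔-mono-≤ le (roots h)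

    child : ∀ {ts as′ as e a′} → Pending ts as′ as → (e , a′) ∈ children (⨆ as′) →
      ∃₂ λ f b → (f , b) ∈ (d , c) ∷ children (⨆ as) × e ≤ f × a′ ≼ b
    child {as′ = node _ cs′ ∷ _} {as = node _ cs ∷ _} ((node _ g , _) ∷ h) p
      with ∈-++⁻ cs′ p
    ... | inj₁ q = let f , b , i , r = g q        in f , b , ∷⁺ʳ _ ∈-++⁺ˡ i , r
    ... | inj₂ q = let f , b , i , r = child h q in f , b , ∷⁺ʳ _ (∈-++⁺ʳ cs) i , r

  -- Variables not in redex arguments occur at the root of the interpretation,
  -- hence one extra child at the root accounts for all the bs.

  interp-applied : ∀ {Γ A ts as′ as bs} {ρ′ ρ : SkelEnv Γ} (M : Tm Γ A) →
    Scoped M ts → Full M (length ts) → Extends ρ′ ρ → Pending ts as′ as →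
    Fits bs (target (length ts) A) →
    interpOn ρ′ M (as′ ++ bs) ≼ interpOn ρ M as ·⟨ d ⟩ c
  -- Fullness leaves no further argument for the head variable, so `bs` is empty.
  interp-applied {as′ = as′} {ρ′ = ρ′} {ρ} (var x) s f e h fits
    with refl ← fits-ground fits f rewrite ++-identityʳ as′ with ρ′ x | ρ x | e x
  ... | nothing | _ | inj₁ refl = pending-⨆ h
  ... | just b  | _ | inj₁ refl = ≼-insert _ b (pending-⨆ h)
  -- Here `x` is bound to one of the further arguments, and the child this creates is matched by
  -- `c`.
  ... | _ | _ | inj₂ (refl , b , refl , le , r) =
    ≼-absorb (≤-trans (≤-reflexive (+-comm _ 1)) le) r (pending-⨆ h)
  interp-applied (∗ A) s f e h fits = node z≤n λ ()
  interp-applied (ƛ M) s f e [] [] =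
    interp-applied M s f (λ { (here _) → inj₁ refl ; (there x) → e x }) [] []
  interp-applied (ƛ M) s f e [] ((le , r) ∷ fits) =
    interp-applied M s f (λ { (here refl) → inj₂ (refl , _ , refl , le , r) ; (there x) → e x }) [] fits
  -- A redex argument does not depend on the environment, so its variable gets the same value on
  -- both sides.
  interp-applied (ƛ M) (k , s) f e ((_ , eq) ∷ h) fits with refl ← eq k =
    interp-applied M s f (λ { (here _) → inj₁ refl ; (there x) → e x }) h fits
  interp-applied {ρ′ = ρ′} {ρ} (M · N) (s , s′) (f , f′) e h fits =
    interp-applied M s f e ((interp-applied N s′ f′ e [] [] , λ k → k ρ′ ρ) ∷ h) fits

-- Simulation of linear head reduction

interpArgs : ∀ {Γ A} → SkelEnv Γ → Args Γ A → List Skel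
interpArgs σ []       = []
interpArgs σ (N ∷ as) = interpOn σ N [] ∷ interpArgs σ as

interp-wk : ∀ {Γ A B} (σ : SkelEnv Γ) b (M : Tm Γ A) →
  interpOn (extend {A = B} σ b) (wk M) [] ≡ interpOn σ M []
interp-wk σ b M = interp-rename (xs⊆x∷xs _ _) M (λ _ → refl) []

interpArgs-wk : ∀ {Γ A B} (σ : SkelEnv Γ) b (as : Args Γ A) →
  interpArgs (extend {A = B} σ b) (wkArgs as) ≡ interpArgs σ as
interpArgs-wk σ b []       = refl
interpArgs-wk σ b (N ∷ as) = cong₂ _∷_ (interp-wk σ b N) (interpArgs-wk σ b as)

interpArgs-fits : ∀ {Γ A d c} {σ : SkelEnv Γ} (as : Args Γ A) → lv A ≤ d →
  (∀ {a} → a ∈ interpArgs σ as → a ≼ c) → Fits d c (interpArgs σ as) A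
interpArgs-fits []       le h = []
interpArgs-fits {A = A ⇒ B} (N ∷ as) le h =
  (m⊔n≤o⇒m≤o _ (lv B) le , h (here refl)) ∷
  interpArgs-fits as (m⊔n≤o⇒n≤o (suc (lv A)) _ le) (h ∘ there)

Good : ∀ {Γ A} → Tm Γ A → Set
Good N = Scoped N [] × Full N 0

Good-wk : ∀ {Γ A B} (N : Tm Γ A) → Good N → Good (wk {B = B} N)
Good-wk N (s , f) = Scoped-rename _ N [] s , Full-rename _ N 0 f

GoodSpine : ∀ {Γ A} → Tm Γ A → Set
GoodSpine (var x) = ⊤
GoodSpine (∗ A)   = ⊤
GoodSpine (ƛ M)   = GoodSpine M
GoodSpine (M · N) = GoodSpine M × Good N

goodSpine : ∀ {Γ A} (M : Tm Γ A) {ts} → Scoped M ts → Full M (length ts) → GoodSpine M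
goodSpine (var x)       s       f       = tt
goodSpine (∗ A)         s       f       = tt
goodSpine (ƛ M) {[]}    s       f       = goodSpine M s f
goodSpine (ƛ M) {_ ∷ _} (_ , s) f       = goodSpine M s f
goodSpine (M · N)       (s , t) (f , g) = goodSpine M s f , (t , g)

GoodArgs : ∀ {Γ A} → Args Γ A → Set
GoodArgs []       = ⊤
GoodArgs (N ∷ as) = Good N × GoodArgs as

GoodArgs-wk : ∀ {Γ A B} (as : Args Γ A) → GoodArgs as → GoodArgs (wkArgs {B = B} as)
GoodArgs-wk []       h       = tt
GoodArgs-wk (N ∷ as) (g , h) = Good-wk N g , GoodArgs-wk as h

Interprets : ∀ {Γ} → SkelEnv Γ → Env Γ → Set
Interprets {Γ} σ ρ = ∀ {A} (x : A ∈ Γ) {N} →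
  ρ x ≡ just N → σ x ≡ just (interpOn σ N []) × Good N

interprets-wk : ∀ {Γ A B} {σ : SkelEnv Γ} {b} {N : Maybe (Tm Γ A)} {s : Maybe Skel} →
  (∀ {P} → N ≡ just P → s ≡ just (interpOn σ P []) × Good P) →
  ∀ {P} → Maybe.map wk N ≡ just P → s ≡ just (interpOn (extend {A = B} σ b) P []) × Good P
interprets-wk {σ = σ} {b} {just N} h refl with h refl
... | refl , g = cong just (sym (interp-wk σ b N)) , Good-wk N g

interprets-▸ : ∀ {Γ A} {σ : SkelEnv Γ} {ρ : Env Γ} (N : Maybe (Tm Γ A)) →
  Interprets σ ρ → (∀ {P} → N ≡ just P → Good P) →
  Interprets (extend σ (Maybe.map (λ P → interpOn σ P []) N)) (ρ ▸ N)
interprets-▸ N i g (here refl) = interprets-wk {N = N} λ { refl → refl , g refl }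
interprets-▸ {ρ = ρ} N i g (there x) = interprets-wk {N = ρ x} (i x)

-- The interpretation descends to the head occurrence and produces the root there, so the
-- abstractions and applications on the way only update the environment and the pending arguments.
headSubst-simulated : ∀ {Γ A} {σ : SkelEnv Γ} {ρ : Env Γ} (M : Tm Γ A) (as : Args Γ A) {M′} →
  Interprets σ ρ → GoodSpine M → GoodArgs as → headSubst ρ M as ≡ just M′ →
  GoodSpine M′ ×
  ∃[ t ] interpOn σ M (interpArgs σ as) ⇝ t × interpOn σ M′ (interpArgs σ as) ≼ t
headSubst-simulated {A = A} {σ} (var x) as {N} i gM gas eq with σ x | i x eq
... | .(just _) | refl , s , f =
  -- The reduction turns the edge `lv A + 1` into `lv A`, which still exceeds the level of every
  -- argument of `x`. The former root dominates the interpretations of these arguments, since it has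
  -- all their children.
  goodSpine N s f , _ , step (here (cong (_, interpOn σ N []) (+-comm 1 (lv A)))) ,
  interp-applied (lv A) _ N s f (λ _ → inj₁ refl) []
    (interpArgs-fits as ≤-refl (≼-⨆-attach _ _))
headSubst-simulated {ρ = ρ} (ƛ M) [] i gM gas eq
  with just P ← headSubst (ρ ▸ nothing) M [] in eq′ | refl ← eq =
  headSubst-simulated M [] (interprets-▸ nothing i λ ()) gM tt eq′
headSubst-simulated {σ = σ} {ρ} (ƛ M) (N ∷ as) i gM (gN , gas) eq
  with just P ← headSubst (ρ ▸ just N) M (wkArgs as) in eq′ | refl ← eq =
  subst (λ ss → _ × ∃[ t ] interpOn σ′ M ss ⇝ t × interpOn σ′ P ss ≼ t)
    (interpArgs-wk σ _ as)
    (headSubst-simulated M (wkArgs as) (interprets-▸ (just N) i λ { refl → gN }) gM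
      (GoodArgs-wk as gas) eq′)
  where
  σ′ = extend σ (just (interpOn σ N []))
headSubst-simulated {ρ = ρ} (M · N) as i (gM , gN) gas eq
  with just P ← headSubst ρ M (N ∷ as) in eq′ | refl ← eq =
  let gP , r = headSubst-simulated M (N ∷ as) i gM (gN , gas) eq′ in (gP , gN) , r

-- The interpretation of a reduct is only below the reduced skeleton; the rest of the sequence is
-- transferred along `≼`.
lhr-simulated : ∀ {Γ A n} {M M′ : Tm Γ A} → GoodSpine M → Steps _→lhr_ n M M′ →
  ∃[ t ] Steps _⇝_ n ⟦ M ⟧ t
lhr-simulated g []             = _ , []
lhr-simulated {M = M} g (r ∷ rs) =
  let g′ , _ , s , le = headSubst-simulated M [] (λ _ ()) g tt r
      _ , ss  = lhr-simulated g′ rs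
      _ , ss′ = ≼-simulates-steps le ss
  in _ , s ∷ ss′

lhr-finitelyBranching : ∀ {Γ A} → FinitelyBranching {R = _→lhr_ {Γ} {A}}
lhr-finitelyBranching M with headSubst (λ _ → nothing) M []
... | nothing = [] , (λ ()) , []
... | just M′ = M′ ∷ [] , (λ { refl → here refl }) , refl ∷ []

-- Bounds on the interpretation

-- Serves depth, node labels and edge labels alike: on a list of children each is a maximum of
-- values `g`.
⨆-children-≤ : ∀ {w} (g : ℕ × Skel → ℕ) (f : List (ℕ × Skel) → ℕ) → f [] ≡ 0 →
  (∀ c cs → f (c ∷ cs) ≡ g c ⊔ f cs) →
  ∀ {as} → All (λ a → f (children a) ≤ w) as → f (children (⨆ as)) ≤ w
⨆-children-≤ g f f[] f∷ []       = ≤-trans (≤-reflexive f[]) z≤n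
⨆-children-≤ {w} g f f[] f∷ {a ∷ as} (h ∷ hs) = append (children a) h
  where
  append : ∀ cs → f cs ≤ w → f (cs ++ children (⨆ as)) ≤ w
  append []       _ = ⨆-children-≤ g f f[] f∷ hs
  append (c ∷ cs) h rewrite f∷ c cs | f∷ c (cs ++ children (⨆ as)) =
    ⊔-lub (m⊔n≤o⇒m≤o (g c) _ h) (append cs (m⊔n≤o⇒n≤o (g c) _ h))

foldr-⊔-≤ : ∀ {w b} ns → foldr _⊔_ b ns ≤ w → b ≤ w × All (_≤ w) ns
foldr-⊔-≤ []       le = le , []
foldr-⊔-≤ (n ∷ ns) le =
  let le′ , h = foldr-⊔-≤ ns (m⊔n≤o⇒n≤o n _ le) in le′ , m⊔n≤o⇒m≤o n _ le ∷ h

-- The bounds are proved against an arbitrary w, so that the environment only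
-- has to be bounded by w.  A pending argument is bounded by w only if its
-- measure is: the heads ∗ ignore their arguments.

≤-depth : ∀ a {w} → depthₛ a ≤ w → depthsₛ (children a) ≤ pred w
≤-depth (node _ _) h = pred-mono-≤ h

data DepthPending (w : ℕ) : List Argument → List Skel → List ℕ → Set where
  []  : DepthPending w [] [] []
  _∷_ : ∀ {t ts a as d ds} →
        (d ≤ w → depthₛ a ≤ w) × (Constant (Argument.term t) → depthₛ a ≤ d) →
        DepthPending w ts as ds → DepthPending w (t ∷ ts) (a ∷ as) (d ∷ ds)

depth-bounds : ∀ {w ts as ds} → DepthPending w ts as ds → All (_≤ w) ds →
  All (λ a → depthsₛ (children a) ≤ pred w) as
depth-bounds []                        []       = []
depth-bounds (_∷_ {a = a} (h , _) hs) (le ∷ les) = ≤-depth a (h le) ∷ depth-bounds hs les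

interp-depth : ∀ {Γ A w ts as ds} {ρ : SkelEnv Γ} (M : Tm Γ A) → Scoped M ts →
  (∀ {B} (x : B ∈ Γ) {b} → ρ x ≡ just b → suc (depthₛ b) ≤ w) →
  DepthPending w ts as ds → depthOn M ds ≤ w → depthₛ (interpOn ρ M as) ≤ w
interp-depth {w = suc w} {as = as} {ds} {ρ} (var x) s e h le with foldr-⊔-≤ ds le | ρ x | e x
... | _ , les | nothing | _  =
  s≤s (⨆-children-≤ (depthₛ ∘ proj₂) depthsₛ refl (λ _ _ → refl) (depth-bounds h les))
... | _ , les | just b  | e′ = s≤s (⊔-lub (≤-pred (e′ refl))
  (⨆-children-≤ (depthₛ ∘ proj₂) depthsₛ refl (λ _ _ → refl) (depth-bounds h les)))
-- The depth of a term with a variable as head is at least 1.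
interp-depth {w = zero} {ds = ds} (var x) s e h le with () ← proj₁ (foldr-⊔-≤ ds le)
interp-depth (∗ A) s e h le = le
interp-depth (ƛ M) s e [] le =
  interp-depth M s (λ { (here refl) () ; (there x) → e x }) [] le
interp-depth (ƛ M) (c , s) e (_∷_ {ds = ds} (_ , k) h) le =
  interp-depth M s
    -- A bound skeleton hangs one level below the root, so it must be bounded by the depth of its
    -- own term, not just by `w`.
    (λ { (here refl) refl → ≤-trans (s≤s (k c)) (m⊔n≤o⇒n≤o (depthOn M ds) _ le) ; (there x) → e x })
    h (m⊔n≤o⇒m≤o (depthOn M ds) _ le)
interp-depth {ρ = ρ} (M · N) (s , t) e h le = interp-depth M s e
  ((interp-depth N t e [] ,
    -- By constancy `N` can be interpreted in the empty environment, where `depth N` itself is an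
    -- admissible bound.
    λ c → subst (λ a → depthₛ a ≤ depth N) (c ∅ ρ)
            (interp-depth {ρ = ∅} N t (λ _ ()) [] ≤-refl)) ∷ h) le

⨆-root-≤ : ∀ {as hs} → Pointwise (λ a h → root a ≤ h) as hs → root (⨆ as) ≤ foldr _⊔_ 0 hs
⨆-root-≤ []       = z≤n
⨆-root-≤ (p ∷ ps) = ⊔-mono-≤ p (⨆-root-≤ ps)

-- The environment contributes children but never changes a root label, so `ρ` is arbitrary.
interp-root : ∀ {Γ A as hs} {ρ : SkelEnv Γ} (M : Tm Γ A) →
  Pointwise (λ a h → root a ≤ h) as hs → root (interpOn ρ M as) ≤ lhOn M hs
interp-root {ρ = ρ} (var x) ps with ρ x
... | nothing = s≤s (⨆-root-≤ ps)
... | just b  = s≤s (⨆-root-≤ ps)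
interp-root (∗ A) ps       = z≤n
interp-root (ƛ M) []       = interp-root M []
interp-root (ƛ M) (p ∷ ps) = ≤-trans (interp-root M ps) (m≤m⊔n _ _)
interp-root (M · N) ps     = interp-root M (interp-root N [] ∷ ps)

MaxPending : ℕ → List Skel → List ℕ → Set
MaxPending w = Pointwise (λ a h → root a ≤ h × (h ≤ w → maxₛ a ≤ w))

≤-max : ∀ a {w} → maxₛ a ≤ w → maxsₛ (children a) ≤ w
≤-max (node n cs) = m⊔n≤o⇒n≤o n _

max-bounds : ∀ {w as hs} → MaxPending w as hs → All (_≤ w) hs →
  All (λ a → maxsₛ (children a) ≤ w) as
max-bounds []                        []         = []
max-bounds (_∷_ {x = a} (_ , p) ps) (le ∷ les) = ≤-max a (p le) ∷ max-bounds ps les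

interp-max : ∀ {Γ A w as hs} {ρ : SkelEnv Γ} (M : Tm Γ A) →
  (∀ {B} (x : B ∈ Γ) {b} → ρ x ≡ just b → maxₛ b ≤ w) →
  MaxPending w as hs → lhOn M hs ≤ w → maxₛ (interpOn ρ M as) ≤ w
interp-max {w = w} {as} {hs} {ρ} (var x) e ps le = helper
  where
  root≤ : suc (root (⨆ as)) ≤ w
  root≤ = ≤-trans (s≤s (⨆-root-≤ (Pointwise.map proj₁ ps))) le

  children≤ : maxsₛ (children (⨆ as)) ≤ w
  children≤ = ⨆-children-≤ (maxₛ ∘ proj₂) maxsₛ refl (λ _ _ → refl)
    (max-bounds ps (proj₂ (foldr-⊔-≤ hs (<⇒≤ le))))

  helper : maxₛ (interpOn ρ (var x) as) ≤ w
  helper with ρ x | e x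
  ... | nothing | _  = ⊔-lub root≤ children≤
  ... | just b  | e′ = ⊔-lub root≤ (⊔-lub (e′ refl) children≤)
interp-max (∗ A) e ps le = z≤n
interp-max (ƛ M) e [] le = interp-max M (λ { (here refl) () ; (there x) → e x }) [] le
interp-max (ƛ M) e (_∷_ {y = h} {ys = hs} (_ , p) ps) le =
  interp-max M
    (λ { (here refl) refl → p (m⊔n≤o⇒n≤o (lhOn M hs) h le) ; (there x) → e x })
    ps (m⊔n≤o⇒m≤o (lhOn M hs) h le)
interp-max (M · N) e ps le = interp-max M e ((interp-root N [] , interp-max N e []) ∷ ps) le

≤-ord : ∀ a {w} → ordₛ a ≤ w → ordsₛ (children a) ≤ w
≤-ord (node _ _) h = h

-- An edge added for a bound variable has label one more than its level, which is at most the level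
-- of the abstraction binding it.
interp-ord : ∀ {Γ A w as} {ρ : SkelEnv Γ} (M : Tm Γ A) →
  (∀ {B} (x : B ∈ Γ) {b} → ρ x ≡ just b → suc (lv B) ≤ w × ordₛ b ≤ w) →
  All (λ a → ordₛ a ≤ w) as → ord M ≤ w → ordₛ (interpOn ρ M as) ≤ w
interp-ord {A = A} {w} {as} {ρ} (var x) e ps le = helper
  where
  children≤ : ordsₛ (children (⨆ as)) ≤ w
  children≤ = ⨆-children-≤ (λ (d , a) → d ⊔ ordₛ a) ordsₛ refl (λ _ _ → refl)
    (All.map (λ {a} → ≤-ord a) ps)

  helper : ordₛ (interpOn ρ (var x) as) ≤ w
  helper with ρ x | e x
  ... | nothing | _  = children≤
  ... | just b  | e′ =
    ⊔-lub (⊔-lub (≤-trans (≤-reflexive (+-comm (lv A) 1)) (proj₁ (e′ refl))) (proj₂ (e′ refl))) children≤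
interp-ord (∗ A) e ps le = z≤n
interp-ord {A = A} (ƛ M) e [] le =
  interp-ord M (λ { (here refl) () ; (there x) → e x }) [] (m⊔n≤o⇒n≤o (lv A) _ le)
interp-ord {A = A ⇒ B} (ƛ M) e (p ∷ ps) le =
  interp-ord M
    (λ { (here refl) refl → m⊔n≤o⇒m≤o _ (lv B) (m⊔n≤o⇒m≤o (lv (A ⇒ B)) _ le) , p ; (there x) → e x })
    ps (m⊔n≤o⇒n≤o (lv (A ⇒ B)) _ le)
interp-ord {A = A} (M · N) e ps le =
  let le′ = m⊔n≤o⇒n≤o (lv A) _ le in
  interp-ord M e (interp-ord N e [] (m⊔n≤o⇒n≤o (ord M) _ le′) ∷ ps) (m⊔n≤o⇒m≤o (ord M) _ le′)

proposition5p36 : ∀ {Γ} (M : Tm Γ o) →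
    StronglyLocallyScoped M → EtaLong M →
    depthₛ ⟦ M ⟧ ≤ depth M ×
    maxₛ ⟦ M ⟧ ≤ lh M ×
    ordₛ ⟦ M ⟧ ≤ ord M ×
    ∃₂ λ m n → MaxLength _→lhr_ M m × MaxLength _⇝_ ⟦ M ⟧ n × m ≤ n
proposition5p36 M sls el =
  interp-depth M scoped (λ _ ()) [] ≤-refl ,
  interp-max M (λ _ ()) [] ≤-refl ,
  interp-ord M (λ _ ()) [] ≤-refl ,
  m , n , longestM , longest⟦M⟧ , bound (proj₂ (proj₁ longestM))
  where
  scoped : Scoped M []
  scoped = stronglyLocallyScoped⇒scoped [] M [] (anti-mono (primeRedexes⊆redexesAt [] M) sls) sls

  full : Full M 0
  full = etaLong⇒full₀ M λ {M′} r → subst₂ _<_ (#redexes≡#matched M) (#redexes≡#matched M′) (el r)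

  maxLength⟦M⟧ = maxLength ⇝-finitelyBranching (⇝-acc (sn ⟦ M ⟧))
  n = proj₁ maxLength⟦M⟧
  longest⟦M⟧ = proj₂ maxLength⟦M⟧

  bound : ∀ {k M′} → Steps _→lhr_ k M M′ → k ≤ n
  bound ss = proj₂ longest⟦M⟧ (proj₂ (lhr-simulated (goodSpine M scoped full) ss))

  -- Termination of linear head reduction is itself a consequence of the simulation.
  maxLengthM = maxLength lhr-finitelyBranching (bounded⇒acc n bound)
  m = proj₁ maxLengthM
  longestM = proj₂ maxLengthM
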